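{- For every derivation in $\mathsf{SKSg}$ with premise $Q$ and conclusion $P$ there exists a derivation in $\mathsf{GS1p}+\mathsf{Cut}$ with premise $\vdash\underline{Q}_{G}$ and conclusion $\vdash\underline{P}_{G}$.
   Context: Structures: generated by $S ::= \mathsf f \mid \mathsf t \mid a \mid [S,\dots,S] \mid (S,\dots,S) \mid \bar S$ (non-empty lists), where $a$ ranges over atoms, $\mathsf f,\mathsf t$ are the units false and true, $[\cdot]$ is disjunction, $(\cdot)$ is conjunction, $\bar S$ is negation; the negation of an atom is again an atom. A context $S\{\ \}$ is a structure with one occurrence of a hole, not in the scope of a negation; $S\{R\}$ is the result of filling it with $R$; $S[R,T]$ abbreviates $S\{[R,T]\}$ and $S(R,T)$ abbreviates $S\{(R,T)\}$. Equivalent structures are not distinguished; equivalence is the smallest equivalence relation induced by: $[\vec R,[\vec T],\vec U]=[\vec R,\vec T,\vec U]$ and $(\vec R,(\vec T),\vec U)=(\vec R,\vec T,\vec U)$ (with $\vec R,\vec T,\vec U$ finite sequences, $\vec T$ non-empty); $[R,T]=[T,R]$, $(R,T)=(T,R)$; $(\mathsf f,\mathsf f)=\mathsf f$, $[\mathsf f,R]=R$, $[\mathsf t,\mathsf t]=\mathsf t$, $(\mathsf t,R)=R$; $\bar{\mathsf f}=\mathsf t$, $\bar{\mathsf t}=\mathsf f$, $\overline{[R,T]}=(\bar R,\bar T)$, $\overline{(R,T)}=[\bar R,\bar T]$, $\bar{\bar R}=R$; and closure: if $R=T$ then $S\{R\}=S\{T\}$ and $\bar R=\bar T$. A derivation in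 a system (set of inference rules) is a finite sequence of rule instances, read top-down, the conclusion of each being the premise of the next; it may consist of a single structure. Its premise is the topmost structure, its conclusion the bottommost. System $\mathsf{SKSg}$ has the rules (written $\frac{\text{premise}}{\text{conclusion}}$, for arbitrary structures $R,T,U$ and contexts $S\{\ \}$): $i{\downarrow}:\frac{S\{\mathsf t\}}{S[R,\bar R]}$, $i{\uparrow}:\frac{S(R,\bar R)}{S\{\mathsf f\}}$, $s:\frac{S([R,U],T)}{S[(R,T),U]}$, $w{\downarrow}:\frac{S\{\mathsf f\}}{S\{R\}}$, $w{\uparrow}:\frac{S\{R\}}{S\{\mathsf t\}}$, $c{\downarrow}:\frac{S[R,R]}{S\{R\}}$, $c{\uparrow}:\frac{S\{R\}}{S(R,R)}$. Sequent system: formulae $A,B$ are built from atoms (closed under negation) and constants $\top,\bot$ with $\wedge,\vee$; negation occurs only on atoms and $\bar A$ denotes the De Morgan dual of $A$. Sequents are finite multisets of formulae. $\mathsf{GS1p}+\mathsf{Cut}$ has the rules: axiom $\top$: infer $\vdash\top$; $\mathsf{Ax}$: infer $\vdash A,\bar A$; $\mathsf R\wedge$: from $\vdash\Phi,A$ and $\vdash\Psi,B$ infer $\vdash\Phi,\Psi,A\wedge B$; $\mathsf R\vee$: from $\vdash\Phi,A,B$ infer $\vdash\Phi,A\vee B$; $\mathsf{RC}$: from $\vdash\Phi,A,A$ infer $\vdash\Phi,A$; $\mathsf{RW}$: from $\vdash\Phi$ infer $\vdash\Phi,A$; $\mathsf{Cut}$: from $\vdash\Phi,A$ and $\vdash\Psi,\bar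 A$ infer $\vdash\Phi,\Psi$. Derivations are trees built by these rules; the premises are the open leaves (not closed by an axiom). For the translation, structures are assumed to contain negation only on atoms and only conjunctions and disjunctions of exactly two structures (every structure is equivalent to such a one). Translation $\underline{\ \cdot\ }_G$: $\underline a_G=a$, $\underline{\mathsf t}_G=\top$, $\underline{\mathsf f}_G=\bot$, $\underline{[R,T]}_G=\underline R_G\vee\underline T_G$, $\underline{(R,T)}_G=\underline R_G\wedge\underline T_G$. -}

module Defs where

open import Data.List.Base using (List; []; _∷_; _++_)
open import Data.List.NonEmpty.Base using (List⁺; _∷_; _++⁺_; _⁺++_)
open import Data.List.Properties using (++-identityʳ)
open import Data.List.Relation.Binary.Permutation.Propositional using (_↭_)
open import Relation.Binary.PropositionalEquality using (_≡_; subst)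

record Atoms : Set₁ where
  field
    Atom              : Set
    negate            : Atom → Atom
    negate-involutive : ∀ a → negate (negate a) ≡ a

module Calculi (𝔸 : Atoms) where

  open Atoms 𝔸 public

  data Structure : Set where
    𝐟 𝐭  : Structure
    atom : Atom → Structure
    disj : List⁺ Structure → Structure
    conj : List⁺ Structure → Structure
    neg  : Structure → Structure

  pattern [_,_] R T = disj (R ∷ T ∷ [])
  pattern ⦅_,_⦆ R T = conj (R ∷ T ∷ [])

  data Context : Set where
    ∙    : Context
    disj : List Structure → Context → List Structure → Context
    conj : List Structure → Context → List Structure → Context

  infix 9 _⟨_⟩

  _⟨_⟩ : Context → Structure → Structure
  ∙           ⟨ R ⟩ = R
  disj Rs S Us ⟨ R ⟩ = disj (Rs ++⁺ (S ⟨ R ⟩ ∷ Us))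
  conj Rs S Us ⟨ R ⟩ = conj (Rs ++⁺ (S ⟨ R ⟩ ∷ Us))

  infix 4 _≈_

  data _≈_ : Structure → Structure → Set where
    ≈-refl     : ∀ {R} → R ≈ R
    ≈-sym      : ∀ {R T} → R ≈ T → T ≈ R
    ≈-trans    : ∀ {R T U} → R ≈ T → T ≈ U → R ≈ U

    disj-assoc : ∀ Rs Ts Us → disj (Rs ++⁺ (disj Ts ∷ Us)) ≈ disj (Rs ++⁺ (Ts ⁺++ Us))
    conj-assoc : ∀ Rs Ts Us → conj (Rs ++⁺ (conj Ts ∷ Us)) ≈ conj (Rs ++⁺ (Ts ⁺++ Us))

    disj-comm  : ∀ R T → [ R , T ] ≈ [ T , R ]
    conj-comm  : ∀ R T → ⦅ R , T ⦆ ≈ ⦅ T , R ⦆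

    conj-𝐟𝐟    : ⦅ 𝐟 , 𝐟 ⦆ ≈ 𝐟
    disj-𝐟     : ∀ R → [ 𝐟 , R ] ≈ R
    disj-𝐭𝐭    : [ 𝐭 , 𝐭 ] ≈ 𝐭
    conj-𝐭     : ∀ R → ⦅ 𝐭 , R ⦆ ≈ R

    neg-𝐟      : neg 𝐟 ≈ 𝐭
    neg-𝐭      : neg 𝐭 ≈ 𝐟
    neg-atom   : ∀ a → neg (atom a) ≈ atom (negate a)
    neg-disj   : ∀ R T → neg [ R , T ] ≈ ⦅ neg R , neg T ⦆
    neg-conj   : ∀ R T → neg ⦅ R , T ⦆ ≈ [ neg R , neg T ]
    neg-neg    : ∀ R → neg (neg R) ≈ R

    ctx-cong   : ∀ S {R T} → R ≈ T → S ⟨ R ⟩ ≈ S ⟨ T ⟩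
    neg-cong   : ∀ {R T} → R ≈ T → neg R ≈ neg T

  -- 𝒮 R T: there is an instance of a rule of 𝒮 with premise R, conclusion T.
  System : Set₁
  System = Structure → Structure → Set

  data SKSg : System where
    i↓ : ∀ S R     → SKSg (S ⟨ 𝐭 ⟩)                   (S ⟨ [ R , neg R ] ⟩)
    i↑ : ∀ S R     → SKSg (S ⟨ ⦅ R , neg R ⦆ ⟩)       (S ⟨ 𝐟 ⟩)
    s  : ∀ S R T U → SKSg (S ⟨ ⦅ [ R , U ] , T ⦆ ⟩)   (S ⟨ [ ⦅ R , T ⦆ , U ] ⟩)
    w↓ : ∀ S R     → SKSg (S ⟨ 𝐟 ⟩)                   (S ⟨ R ⟩)
    w↑ : ∀ S R     → SKSg (S ⟨ R ⟩)                   (S ⟨ 𝐭 ⟩)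
    c↓ : ∀ S R     → SKSg (S ⟨ [ R , R ] ⟩)           (S ⟨ R ⟩)
    c↑ : ∀ S R     → SKSg (S ⟨ R ⟩)                   (S ⟨ ⦅ R , R ⦆ ⟩)

  -- Derivation 𝒮 Q P has premise Q and conclusion P.  Equivalent structures
  -- are not distinguished, so consecutive structures are matched up to _≈_.
  data Derivation (𝒮 : System) : Structure → Structure → Set where
    structure : ∀ {Q P} → Q ≈ P → Derivation 𝒮 Q P
    step      : ∀ {Q R T P} → Q ≈ R → 𝒮 R T → Derivation 𝒮 T P → Derivation 𝒮 Q P

  infixr 7 _∧_
  infixr 6 _∨_

  data Formula : Set where
    atom    : Atom → Formula
    ⊤ ⊥     : Formula
    _∧_ _∨_ : Formula → Formula → Formula

  dual : Formula → Formula
  dual (atom a) = atom (negate a)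
  dual ⊤        = ⊥
  dual ⊥        = ⊤
  dual (A ∧ B)  = dual A ∨ dual B
  dual (A ∨ B)  = dual A ∧ dual B

  -- Finite multisets are lists up to permutation.
  Sequent : Set
  Sequent = List Formula

  -- GS1p+Cut Πs Γ: trees with conclusion ⊢ Γ whose open leaves are exactly
  -- Πs, from left to right and with repetitions.
  data GS1p+Cut : List Sequent → Sequent → Set where
    leaf  : ∀ Γ → GS1p+Cut (Γ ∷ []) Γ
    -- Not a rule of the calculus: identifies lists denoting the same multiset.
    perm  : ∀ {Πs Γ Δ} → Γ ↭ Δ → GS1p+Cut Πs Γ → GS1p+Cut Πs Δ
    axiom⊤ : GS1p+Cut [] (⊤ ∷ [])
    Ax    : ∀ A → GS1p+Cut [] (A ∷ dual A ∷ [])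
    R∧    : ∀ {Πs Σs Φ Ψ A B} → GS1p+Cut Πs (A ∷ Φ) → GS1p+Cut Σs (B ∷ Ψ) →
            GS1p+Cut (Πs ++ Σs) (A ∧ B ∷ Φ ++ Ψ)
    R∨    : ∀ {Πs Φ A B} → GS1p+Cut Πs (A ∷ B ∷ Φ) → GS1p+Cut Πs (A ∨ B ∷ Φ)
    RC    : ∀ {Πs Φ A} → GS1p+Cut Πs (A ∷ A ∷ Φ) → GS1p+Cut Πs (A ∷ Φ)
    RW    : ∀ {Πs Φ} A → GS1p+Cut Πs Φ → GS1p+Cut Πs (A ∷ Φ)
    Cut   : ∀ {Πs Σs Φ Ψ} A → GS1p+Cut Πs (A ∷ Φ) → GS1p+Cut Σs (dual A ∷ Ψ) →
            GS1p+Cut (Πs ++ Σs) (Φ ++ Ψ)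

  -- Negation only on atoms, and only binary conjunctions and disjunctions.
  data Translatable : Structure → Set where
    𝐟        : Translatable 𝐟
    𝐭        : Translatable 𝐭
    atom     : ∀ a → Translatable (atom a)
    neg-atom : ∀ a → Translatable (neg (atom a))
    disj     : ∀ {R T} → Translatable R → Translatable T → Translatable [ R , T ]
    conj     : ∀ {R T} → Translatable R → Translatable T → Translatable ⦅ R , T ⦆

  translate : ∀ {R} → Translatable R → Formula
  translate 𝐟            = ⊥
  translate 𝐭            = ⊤
  translate (atom a)     = atom a
  translate (neg-atom a) = atom (negate a)
  translate (disj r t)   = translate r ∨ translate t
  translate (conj r t)   = translate r ∧ translate t

  -- The translation is not invariant under _≈_: it depends on which
  -- translatable structure is chosen to represent R.  One always exists, see
  -- represent below.
  record Representative (R : Structure) : Set where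
    constructor rep
    field
      {representative} : Structure
      equivalent       : R ≈ representative
      translatable     : Translatable representative

  infix 10 _ᴳ

  _ᴳ : ∀ {R} → Representative R → Formula
  r ᴳ = translate (Representative.translatable r)

  disj-singleton : ∀ R → disj (R ∷ []) ≈ R
  disj-singleton R =
    ≈-trans (≈-sym (disj-𝐟 _))
      (≈-trans (disj-assoc (𝐟 ∷ []) (R ∷ []) []) (disj-𝐟 R))

  conj-singleton : ∀ R → conj (R ∷ []) ≈ R
  conj-singleton R =
    ≈-trans (≈-sym (conj-𝐭 _))
      (≈-trans (conj-assoc (𝐭 ∷ []) (R ∷ []) []) (conj-𝐭 R))

  disj-cons : ∀ R T Us → disj (R ∷ T ∷ Us) ≈ [ R , disj (T ∷ Us) ]
  disj-cons R T Us = ≈-sym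
    (subst (λ Vs → [ R , disj (T ∷ Us) ] ≈ disj (R ∷ T ∷ Vs)) (++-identityʳ Us)
      (disj-assoc (R ∷ []) (T ∷ Us) []))

  conj-cons : ∀ R T Us → conj (R ∷ T ∷ Us) ≈ ⦅ R , conj (T ∷ Us) ⦆
  conj-cons R T Us = ≈-sym
    (subst (λ Vs → ⦅ R , conj (T ∷ Us) ⦆ ≈ conj (R ∷ T ∷ Vs)) (++-identityʳ Us)
      (conj-assoc (R ∷ []) (T ∷ Us) []))

  private
    via : ∀ {R T} → R ≈ T → Representative T → Representative R
    via R≈T (rep T≈T′ t) = rep (≈-trans R≈T T≈T′) t

    disj₂ : ∀ {R T} → Representative R → Representative T → Representative [ R , T ]
    disj₂ {T = T} (rep e r) (rep e′ t) =
      rep (≈-trans (ctx-cong (disj [] ∙ (T ∷ [])) e) (ctx-cong (disj (_ ∷ []) ∙ []) e′))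
          (disj r t)

    conj₂ : ∀ {R T} → Representative R → Representative T → Representative ⦅ R , T ⦆
    conj₂ {T = T} (rep e r) (rep e′ t) =
      rep (≈-trans (ctx-cong (conj [] ∙ (T ∷ [])) e) (ctx-cong (conj (_ ∷ []) ∙ []) e′))
          (conj r t)

  mutual
    represent : ∀ R → Representative R
    represent 𝐟               = rep ≈-refl 𝐟
    represent 𝐭               = rep ≈-refl 𝐭
    represent (atom a)        = rep ≈-refl (atom a)
    represent (disj (R ∷ Ts)) = represent-disj R Ts
    represent (conj (R ∷ Ts)) = represent-conj R Ts
    represent (neg R)         = represent-neg R

    represent-disj : ∀ R Ts → Representative (disj (R ∷ Ts))
    represent-disj R []       = via (disj-singleton R) (represent R)
    represent-disj R (T ∷ Us) =
      via (disj-cons R T Us) (disj₂ (represent R) (represent-disj T Us))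

    represent-conj : ∀ R Ts → Representative (conj (R ∷ Ts))
    represent-conj R []       = via (conj-singleton R) (represent R)
    represent-conj R (T ∷ Us) =
      via (conj-cons R T Us) (conj₂ (represent R) (represent-conj T Us))

    represent-neg : ∀ R → Representative (neg R)
    represent-neg 𝐟               = rep neg-𝐟 𝐭
    represent-neg 𝐭               = rep neg-𝐭 𝐟
    represent-neg (atom a)        = rep ≈-refl (neg-atom a)
    represent-neg (disj (R ∷ Ts)) = represent-neg-disj R Ts
    represent-neg (conj (R ∷ Ts)) = represent-neg-conj R Ts
    represent-neg (neg R)         = via (neg-neg R) (represent R)

    represent-neg-disj : ∀ R Ts → Representative (neg (disj (R ∷ Ts)))
    represent-neg-disj R []       = via (neg-cong (disj-singleton R)) (represent-neg R)
    represent-neg-disj R (T ∷ Us) =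
      via (≈-trans (neg-cong (disj-cons R T Us)) (neg-disj R (disj (T ∷ Us))))
          (conj₂ (represent-neg R) (represent-neg-disj T Us))

    represent-neg-conj : ∀ R Ts → Representative (neg (conj (R ∷ Ts)))
    represent-neg-conj R []       = via (neg-cong (conj-singleton R)) (represent-neg R)
    represent-neg-conj R (T ∷ Us) =
      via (≈-trans (neg-cong (conj-cons R T Us)) (neg-conj R (conj (T ∷ Us))))
          (disj₂ (represent-neg R) (represent-neg-conj T Us))

{-# OPTIONS --safe #-}
-- Structures are read as formulae by folding the n-ary connectives and taking
-- De Morgan duals for negations.  With A ⊢ B standing for a closed derivation
-- of ⊢ Ā, B, formulae form a bounded lattice (Cut is transitivity) in which
-- equivalent structures are interdeducible and every SKSg rule descends from
-- its premise to its conclusion.  A derivation from Q to P thus gives Q ⊢ P, and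
-- a single final Cut against the open leaf ⊢ Q yields ⊢ P.
module Submission where

open import Data.List.Base using (List; []; _∷_; _++_)
open import Data.List.NonEmpty.Base using (_∷_; toList; _++⁺_; _⁺++_)
open import Data.List.Relation.Binary.Permutation.Propositional using (↭-refl; prep; swap)
open import Data.Product.Base using (_,_; proj₁; proj₂)
open import Level using (0ℓ)
open import Relation.Binary.Bundles using (Preorder; Setoid)
open import Relation.Binary.Lattice
  using (BoundedJoinSemilattice; BoundedLattice; IsBoundedJoinSemilattice)
open import Relation.Binary.PropositionalEquality
  using (_≡_; refl; sym; cong₂; subst; isEquivalence)
import Relation.Binary.Lattice.Properties.BoundedJoinSemilattice as BoundedJoin
import Relation.Binary.Lattice.Properties.BoundedMeetSemilattice as BoundedMeet
import Relation.Binary.Lattice.Properties.JoinSemilattice as Join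
import Relation.Binary.Properties.Preorder as PreorderProperties
open import Defs

module Soundness (𝔸 : Atoms) where

  open Calculi 𝔸

  dual-involutive : ∀ A → dual (dual A) ≡ A
  dual-involutive (atom a) rewrite negate-involutive a = refl
  dual-involutive ⊤        = refl
  dual-involutive ⊥        = refl
  dual-involutive (A ∧ B)  = cong₂ _∧_ (dual-involutive A) (dual-involutive B)
  dual-involutive (A ∨ B)  = cong₂ _∨_ (dual-involutive A) (dual-involutive B)

  exchange : ∀ {Πs A B Φ} → GS1p+Cut Πs (A ∷ B ∷ Φ) → GS1p+Cut Πs (B ∷ A ∷ Φ)
  exchange = perm (swap _ _ ↭-refl)

  exchange₂ : ∀ {Πs A B C Φ} → GS1p+Cut Πs (A ∷ B ∷ C ∷ Φ) → GS1p+Cut Πs (A ∷ C ∷ B ∷ Φ)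
  exchange₂ = perm (prep _ (swap _ _ ↭-refl))

  -- `R∧` concatenates the contexts, so `C` arrives twice and `RC` merges the copies.
  R∧-shared : ∀ {Πs Σs A B C} → GS1p+Cut Πs (A ∷ C ∷ []) → GS1p+Cut Σs (B ∷ C ∷ []) →
              GS1p+Cut (Πs ++ Σs) (A ∧ B ∷ C ∷ [])
  R∧-shared d e = exchange (RC (exchange₂ (exchange (R∧ d e))))

  infix 4 _⊢_

  -- A record, so that A can be inferred: it is hidden under dual otherwise.
  record _⊢_ (A B : Formula) : Set where
    constructor entails
    field derivation : GS1p+Cut [] (dual A ∷ B ∷ [])

  ⊢-trans : ∀ {A B C} → A ⊢ B → B ⊢ C → A ⊢ C
  ⊢-trans {B = B} (entails d) (entails e) = entails (Cut B (exchange d) e)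

  dual-antitone : ∀ {A B} → A ⊢ B → dual B ⊢ dual A
  dual-antitone {A} {B} (entails d) = entails
    (subst (λ C → GS1p+Cut [] (C ∷ dual A ∷ [])) (sym (dual-involutive B)) (exchange d))

  ⊢-preorder : Preorder 0ℓ 0ℓ 0ℓ
  ⊢-preorder = record
    { _≈_        = _≡_
    ; _≲_        = _⊢_
    ; isPreorder = record
      { isEquivalence = isEquivalence
      ; reflexive     = λ { {A} refl → entails (exchange (Ax A)) }
      ; trans         = ⊢-trans
      }
    }

  open PreorderProperties ⊢-preorder using (InducedEquivalence)

  ⊢-boundedLattice : BoundedLattice 0ℓ 0ℓ 0ℓ
  ⊢-boundedLattice = record
    { _≤_              = _⊢_
    ; _∨_              = _∨_
    ; _∧_              = _∧_
    ; ⊤                = ⊤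
    ; ⊥                = ⊥
    ; isBoundedLattice = record
      { isLattice = record
        { isPartialOrder = record
          { isPreorder = record
            -- Lattice equality is mutual entailment, which makes antisymmetry mere pairing.
            { isEquivalence = Setoid.isEquivalence InducedEquivalence
            ; reflexive     = proj₁
            ; trans         = ⊢-trans
            }
          ; antisym    = _,_
          }
        ; supremum       = λ A B →
            entails (exchange (R∨ (exchange (RW B (Ax A))))) ,
            entails (exchange (R∨ (RW A (Ax B)))) ,
            -- `dual` turns the disjunctive hypothesis into a conjunction to be proved.
            λ _ (entails d) (entails e) → entails (R∧-shared d e)
        ; infimum        = λ A B →
            entails (R∨ (exchange (RW (dual B) (exchange (Ax A))))) ,
            entails (R∨ (RW (dual A) (exchange (Ax B)))) ,
            λ _ (entails d) (entails e) → entails (exchange (R∧-shared (exchange d) (exchange e)))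
        }
      ; maximum   = λ A → entails (RW (dual A) axiom⊤)
      ; minimum   = λ A → entails (exchange (RW A axiom⊤))
      }
    }

  open BoundedLattice ⊢-boundedLattice
    using (minimum; maximum; isBoundedJoinSemilattice; boundedMeetSemilattice)
    renaming (_≈_ to _⊣⊢_; module Eq to ⊣⊢)

  ⊤⊢A∨Ā : ∀ A → ⊤ ⊢ A ∨ dual A
  ⊤⊢A∨Ā A = entails (RW ⊥ (R∨ (Ax A)))

  -- The dual of the hypothesis is literally the excluded middle of `dual A`, so no double dual has
  -- to be removed.
  A∧Ā⊢⊥ : ∀ A → A ∧ dual A ⊢ ⊥
  A∧Ā⊢⊥ A = entails (exchange (RW ⊥ (R∨ (Ax (dual A)))))

  -- Three axioms suffice: two `R∧` build `A ∧ B` and then `dual A ∧ dual C`; each `R∨` joins one of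
  -- these with a leftover formula.
  switch : ∀ A B C → (A ∨ C) ∧ B ⊢ (A ∧ B) ∨ C
  switch A B C = entails (exchange (R∨ (exchange₂ (exchange (R∨ (exchange₂
    (R∧ (exchange (R∧ (Ax A) (Ax B))) (exchange (Ax C)))))))))

  mutual
    -- Unlike `translate`, this covers every structure. Each fold ends in its unit, so a binary
    -- disjunction reads as `A ∨ (B ∨ ⊥)`; `fold-pair` drops the unit.
    ⟦_⟧ : Structure → Formula
    ⟦ 𝐟 ⟧             = ⊥
    ⟦ 𝐭 ⟧             = ⊤
    ⟦ atom a ⟧        = atom a
    ⟦ disj (R ∷ Rs) ⟧ = ⟦ R ⟧ ∨ fold _∨_ ⊥ Rs
    ⟦ conj (R ∷ Rs) ⟧ = ⟦ R ⟧ ∧ fold _∧_ ⊤ Rs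
    ⟦ neg R ⟧         = dual ⟦ R ⟧

    fold : (Formula → Formula → Formula) → Formula → List Structure → Formula
    fold _·_ ε []       = ε
    fold _·_ ε (R ∷ Rs) = ⟦ R ⟧ · fold _·_ ε Rs

  module Fold {_≤_ : Formula → Formula → Set} {_·_ ε}
    (isBoundedJoin : IsBoundedJoinSemilattice _⊣⊢_ _≤_ _·_ ε) where

    open IsBoundedJoinSemilattice isBoundedJoin using () renaming (refl to ≤-refl)

    private
      B : BoundedJoinSemilattice 0ℓ 0ℓ 0ℓ
      B = record { isBoundedJoinSemilattice = isBoundedJoin }

    open BoundedJoin B using (identityˡ; identityʳ) public
    open Join (BoundedJoinSemilattice.joinSemilattice B)
      renaming (∨-monotonic to ·-mono; ∨-cong to ·-cong; ∨-comm to ·-comm;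
                ∨-assoc to ·-assoc; ∨-idempotent to ·-idem) public

    fold-++ : ∀ Rs Ts → fold _·_ ε (Rs ++ Ts) ⊣⊢ (fold _·_ ε Rs · fold _·_ ε Ts)
    fold-++ []       Ts = ⊣⊢.sym (identityˡ _)
    fold-++ (R ∷ Rs) Ts = ⊣⊢.trans (·-cong ⊣⊢.refl (fold-++ Rs Ts)) (⊣⊢.sym (·-assoc _ _ _))

    -- Associativity for either connective: `T` stands for the nested `disj Ts` or `conj Ts`, for
    -- which the hypothesis is reflexivity.
    fold-flatten : ∀ Rs {T} Ts Us → ⟦ T ⟧ ⊣⊢ fold _·_ ε (toList Ts) →
                   fold _·_ ε (toList (Rs ++⁺ (T ∷ Us))) ⊣⊢
                   fold _·_ ε (toList (Rs ++⁺ (Ts ⁺++ Us)))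
    fold-flatten []       Ts Us T≈Ts =
      ⊣⊢.trans (·-cong T≈Ts ⊣⊢.refl) (⊣⊢.sym (fold-++ (toList Ts) Us))
    fold-flatten (R ∷ Rs) Ts Us T≈Ts = ·-cong ⊣⊢.refl (fold-flatten Rs Ts Us T≈Ts)

    fold-mono : ∀ Rs {R T} Us → ⟦ R ⟧ ≤ ⟦ T ⟧ →
                fold _·_ ε (toList (Rs ++⁺ (R ∷ Us))) ≤ fold _·_ ε (toList (Rs ++⁺ (T ∷ Us)))
    fold-mono []       Us R≤T = ·-mono R≤T ≤-refl
    fold-mono (_ ∷ Rs) Us R≤T = ·-mono ≤-refl (fold-mono Rs Us R≤T)

    fold-pair : ∀ R T → fold _·_ ε (R ∷ T ∷ []) ⊣⊢ (⟦ R ⟧ · ⟦ T ⟧)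
    fold-pair R T = ·-cong ⊣⊢.refl (identityʳ _)

    fold-comm : ∀ R T → fold _·_ ε (R ∷ T ∷ []) ⊣⊢ fold _·_ ε (T ∷ R ∷ [])
    fold-comm R T = ⊣⊢.trans (fold-pair R T) (⊣⊢.trans (·-comm _ _) (⊣⊢.sym (fold-pair T R)))

    fold-idem : ∀ R → fold _·_ ε (R ∷ R ∷ []) ⊣⊢ ⟦ R ⟧
    fold-idem R = ⊣⊢.trans (fold-pair R R) (·-idem _)

    fold-unit : ∀ R T → ⟦ R ⟧ ≡ ε → fold _·_ ε (R ∷ T ∷ []) ⊣⊢ ⟦ T ⟧
    fold-unit R T refl = ⊣⊢.trans (fold-pair R T) (identityˡ _)

  module Disj = Fold isBoundedJoinSemilattice
  -- Meets are joins for the reversed order; the equality `_⊣⊢_` is unchanged.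
  module Conj = Fold (BoundedMeet.dualIsBoundedJoinSemilattice boundedMeetSemilattice)

  -- A hole never lies under a negation, so only monotone connectives surround it.
  ⟨⟩-mono : ∀ S {R T} → ⟦ R ⟧ ⊢ ⟦ T ⟧ → ⟦ S ⟨ R ⟩ ⟧ ⊢ ⟦ S ⟨ T ⟩ ⟧
  ⟨⟩-mono ∙              R⊢T = R⊢T
  ⟨⟩-mono (disj Rs S Us) R⊢T = Disj.fold-mono Rs Us (⟨⟩-mono S R⊢T)
  -- The order of `Conj` is reversed, so the two fillings swap roles here.
  ⟨⟩-mono (conj Rs S Us) R⊢T = Conj.fold-mono Rs Us (⟨⟩-mono S R⊢T)

  ≈⇒⊣⊢ : ∀ {R T} → R ≈ T → ⟦ R ⟧ ⊣⊢ ⟦ T ⟧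
  ≈⇒⊣⊢ ≈-refl                = ⊣⊢.refl
  ≈⇒⊣⊢ (≈-sym e)             = ⊣⊢.sym (≈⇒⊣⊢ e)
  ≈⇒⊣⊢ (≈-trans e f)         = ⊣⊢.trans (≈⇒⊣⊢ e) (≈⇒⊣⊢ f)
  ≈⇒⊣⊢ (disj-assoc Rs Ts Us) = Disj.fold-flatten Rs Ts Us ⊣⊢.refl
  ≈⇒⊣⊢ (conj-assoc Rs Ts Us) = Conj.fold-flatten Rs Ts Us ⊣⊢.refl
  ≈⇒⊣⊢ (disj-comm R T)       = Disj.fold-comm R T
  ≈⇒⊣⊢ (conj-comm R T)       = Conj.fold-comm R T
  ≈⇒⊣⊢ conj-𝐟𝐟               = Conj.fold-idem 𝐟
  ≈⇒⊣⊢ (disj-𝐟 R)            = Disj.fold-unit 𝐟 R refl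
  ≈⇒⊣⊢ disj-𝐭𝐭               = Disj.fold-idem 𝐭
  ≈⇒⊣⊢ (conj-𝐭 R)            = Conj.fold-unit 𝐭 R refl
  ≈⇒⊣⊢ neg-𝐟                 = ⊣⊢.refl
  ≈⇒⊣⊢ neg-𝐭                 = ⊣⊢.refl
  ≈⇒⊣⊢ (neg-atom a)          = ⊣⊢.refl
  -- `dual` sends the trailing unit of one fold to that of the other, so both sides compute to the
  -- same formula.
  ≈⇒⊣⊢ (neg-disj R T)        = ⊣⊢.refl
  ≈⇒⊣⊢ (neg-conj R T)        = ⊣⊢.refl
  ≈⇒⊣⊢ (neg-neg R)           = ⊣⊢.reflexive (dual-involutive ⟦ R ⟧)
  ≈⇒⊣⊢ (ctx-cong S e)        = let p , q = ≈⇒⊣⊢ e in ⟨⟩-mono S p , ⟨⟩-mono S q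
  ≈⇒⊣⊢ (neg-cong e)          = let p , q = ≈⇒⊣⊢ e in dual-antitone q , dual-antitone p

  SKSg⇒⊢ : ∀ {R T} → SKSg R T → ⟦ R ⟧ ⊢ ⟦ T ⟧
  SKSg⇒⊢ (i↓ S R)    = ⟨⟩-mono S (⊢-trans (⊤⊢A∨Ā ⟦ R ⟧) (proj₂ (Disj.fold-pair R (neg R))))
  SKSg⇒⊢ (i↑ S R)    = ⟨⟩-mono S (⊢-trans (proj₁ (Conj.fold-pair R (neg R))) (A∧Ā⊢⊥ ⟦ R ⟧))
  -- Keeping the trailing units inside the instantiated formulae makes both sides match by
  -- computation.
  SKSg⇒⊢ (s S R T U) = ⟨⟩-mono S (switch ⟦ R ⟧ (fold _∧_ ⊤ (T ∷ [])) (fold _∨_ ⊥ (U ∷ [])))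
  SKSg⇒⊢ (w↓ S R)    = ⟨⟩-mono S (minimum ⟦ R ⟧)
  SKSg⇒⊢ (w↑ S R)    = ⟨⟩-mono S (maximum ⟦ R ⟧)
  SKSg⇒⊢ (c↓ S R)    = ⟨⟩-mono S (proj₁ (Disj.fold-idem R))
  SKSg⇒⊢ (c↑ S R)    = ⟨⟩-mono S (proj₂ (Conj.fold-idem R))

  Derivation⇒⊢ : ∀ {Q P} → Derivation SKSg Q P → ⟦ Q ⟧ ⊢ ⟦ P ⟧
  Derivation⇒⊢ (structure Q≈P) = proj₁ (≈⇒⊣⊢ Q≈P)
  Derivation⇒⊢ (step Q≈R r d)  = ⊢-trans (proj₁ (≈⇒⊣⊢ Q≈R)) (⊢-trans (SKSg⇒⊢ r) (Derivation⇒⊢ d))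

  translate-⊣⊢ : ∀ {R} (r : Translatable R) → translate r ⊣⊢ ⟦ R ⟧
  translate-⊣⊢ 𝐟                  = ⊣⊢.refl
  translate-⊣⊢ 𝐭                  = ⊣⊢.refl
  translate-⊣⊢ (atom a)           = ⊣⊢.refl
  translate-⊣⊢ (neg-atom a)       = ⊣⊢.refl
  translate-⊣⊢ (disj {R} {T} r t) =
    ⊣⊢.trans (Disj.·-cong (translate-⊣⊢ r) (translate-⊣⊢ t)) (⊣⊢.sym (Disj.fold-pair R T))
  translate-⊣⊢ (conj {R} {T} r t) =
    ⊣⊢.trans (Conj.·-cong (translate-⊣⊢ r) (translate-⊣⊢ t)) (⊣⊢.sym (Conj.fold-pair R T))

  -- Makes the choice of representative immaterial: all translations of `R` are interdeducible with
  -- one formula.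
  ᴳ-⊣⊢ : ∀ {R} (r : Representative R) → r ᴳ ⊣⊢ ⟦ R ⟧
  ᴳ-⊣⊢ (rep e r) = ⊣⊢.trans (translate-⊣⊢ r) (⊣⊢.sym (≈⇒⊣⊢ e))

  discharge : ∀ {A B} → A ⊢ B → GS1p+Cut ((A ∷ []) ∷ []) (B ∷ [])
  -- The right premise is closed, so the leaf for `A` is the only open one.
  discharge {A} (entails d) = Cut A (leaf (A ∷ [])) d

theorem3p12 : (𝔸 : Atoms) → let open Calculi 𝔸 in
    ∀ {Q P : Structure} → Derivation SKSg Q P →
    (Q′ : Representative Q) (P′ : Representative P) →
    GS1p+Cut ((Q′ ᴳ ∷ []) ∷ []) (P′ ᴳ ∷ [])
theorem3p12 𝔸 d Q′ P′ =
  discharge (⊢-trans (proj₁ (ᴳ-⊣⊢ Q′)) (⊢-trans (Derivation⇒⊢ d) (proj₂ (ᴳ-⊣⊢ P′))))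
  where open Soundness 𝔸
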